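{- Let $\langle P,V\rangle$ and $\langle Q,V\rangle$ be states (with the same valuation $V$) in the labelled transition system with state set $\mathcal{P}\times\mathcal{V}$ and label set $TL$, and suppose that all states reachable from $\langle P,V\rangle$ and from $\langle Q,V\rangle$ are image-finite. Then $\langle P,V\rangle$ and $\langle Q,V\rangle$ are state-based bisimilar if and only if for all $\mathrm{HML}^{check}$ formulas $\phi$ we have $\langle P,V\rangle\in[\![\phi]\!]\Leftrightarrow\langle Q,V\rangle\in[\![\phi]\!]$.
   Context: **Process algebra with global variables.** Fix a data domain $D$, a finite set $Var$ of global variable names, a set $Act$ of actions, and a set $PN$ of process names. The transition labels are $TL = Act\cup\{assign(v,d)\mid v\in Var, d\in D\}$ (with $assign(v,d)$ formal labels). Process expressions (the set $\mathcal{P}$) are generated by $$P ::= \lambda.P \mid \delta \mid P+P \mid P\|P \mid \partial_B(P) \mid X \mid (v=d)\to P,$$ with $\lambda\in TL$, $B\subseteq Act$, $X\in PN$, $v\in Var$, $d\in D$. A recursive specification is fixed, containing exactly one equation $X\stackrel{\mathrm{def}}{=}t$ with $t\in\mathcal{P}$ for every $X\in PN$; it is guarded: in each equation $X\stackrel{\mathrm{def}}{=}t$ every occurrence of $X$ in $t$ is in the scope of an action prefix. A partial, commutative and associative function $\gamma:Act\times Act\rightharpoonup Act$ is fixed, such that if $\gamma(a,b)=c$ then $\gamma(c,d)$ is undefined for every $d$. A valuation is a function $V:Var\to D$; $\mathcal{V}$ is the set of valuations, and $V[v\mapsto d]$ is $V$ updated to map $v$ to $d$. States are pairs $\langle P,V\rangle\in\mathcal{P}\times\mathcal{V}$.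 The transition relation is the least relation closed under (with $a,b,c\in Act$, $\lambda\in TL$): - $\langle a.P,V\rangle\xrightarrow{a}\langle P,V\rangle$; $\langle assign(v,d).P,V\rangle\xrightarrow{assign(v,d)}\langle P,V[v\mapsto d]\rangle$; - if $\langle P,V\rangle\xrightarrow{\lambda}\langle P',V'\rangle$ then: $\langle (v=d)\to P,V\rangle\xrightarrow{\lambda}\langle P',V'\rangle$ provided $V(v)=d$; $\langle X,V\rangle\xrightarrow{\lambda}\langle P',V'\rangle$ provided $X\stackrel{\mathrm{def}}{=}P$; $\langle P+Q,V\rangle\xrightarrow{\lambda}\langle P',V'\rangle$ and $\langle Q+P,V\rangle\xrightarrow{\lambda}\langle P',V'\rangle$; $\langle P\|Q,V\rangle\xrightarrow{\lambda}\langle P'\|Q,V'\rangle$ and $\langle Q\|P,V\rangle\xrightarrow{\lambda}\langle Q\|P',V'\rangle$; $\langle\partial_B(P),V\rangle\xrightarrow{\lambda}\langle\partial_B(P'),V'\rangle$ provided $\lambda\notin B$; - if $\langle P,V\rangle\xrightarrow{a}\langle P',V\rangle$, $\langle Q,V\rangle\xrightarrow{b}\langle Q',V\rangle$ and $\gamma(a,b)=c$, then $\langle P\|Q,V\rangle\xrightarrow{c}\langle P'\|Q',V\rangle$. **State-based bisimilarity.** $R\subseteq(\mathcal{P}\times\mathcal{V})\times(\mathcal{P}\times\mathcal{V})$ is a state-based bisimulation if $(\langle P,V_1\rangle,\langle Q,V_2\rangle)\in R$ implies $V_1=V_2$ and, for all $\lambda\in TL$: whenever $\langle P,V_1\rangle\xrightarrow{\lambda}\langle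 P',V'\rangle$ there is $Q'$ with $\langle Q,V_2\rangle\xrightarrow{\lambda}\langle Q',V'\rangle$ and $(\langle P',V'\rangle,\langle Q',V'\rangle)\in R$; and whenever $\langle Q,V_2\rangle\xrightarrow{\lambda}\langle Q',V'\rangle$ there is $P'$ with $\langle P,V_1\rangle\xrightarrow{\lambda}\langle P',V'\rangle$ and $(\langle P',V'\rangle,\langle Q',V'\rangle)\in R$. Two states are state-based bisimilar if some state-based bisimulation relates them. **Reachability and image-finiteness.** A state $s'$ is reachable from $s$ if there is a finite (possibly empty) sequence of transitions from $s$ to $s'$. A state $\langle P,V\rangle$ is image-finite if for every label $\lambda$ the set $\{\langle P',V'\rangle\mid\langle P,V\rangle\xrightarrow{\lambda}\langle P',V'\rangle\}$ is finite. **Logic $\mathrm{HML}^{check}$.** Formulas: $$\phi ::= true\mid false\mid (v=e)\mid\neg\phi\mid\phi\wedge\phi\mid\phi\vee\phi\mid\langle T\rangle\phi\mid[T]\phi,$$ with $T$ a nonempty finite subset of $TL$, $v\in Var$, $e\in D$. With $S=\mathcal{P}\times\mathcal{V}$, the interpretation $[\![\phi]\!]\subseteq S$ is: $[\![true]\!]=S$, $[\![false]\!]=\emptyset$, $[\![v=e]\!]=\{\langle P,V\rangle\mid V(v)=e\}$; $\neg,\wedge,\vee$ are complement, intersection, union; $[\![\langle T\rangle\phi]\!]=\{u\mid\exists u'\in[\![\phi]\!],\lambda\in T: u\xrightarrow{\lambda}u'\}$; $[\![[T]\phi]\!]=\{u\mid\forall u'\in S,\lambda\in T: u\xrightarrow{\lambda}u'\Rightarrow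 u'\in[\![\phi]\!]\}$. -}

module Defs where

open import Level using (0ℓ)
open import Data.Bool using (Bool; T)
open import Data.Fin using (Fin)
open import Data.List using (List)
open import Data.List.Membership.Propositional using () renaming (_∈_ to _∈ˡ_)
open import Data.List.NonEmpty using (List⁺; toList)
open import Data.Maybe using (Maybe; just; nothing; _>>=_)
open import Data.Nat using (ℕ)
open import Data.Product using (_×_; _,_; ∃-syntax)
open import Data.Vec using (Vec; lookup; _[_]≔_)
open import Function.Bundles using (_⇔_)
open import Relation.Binary.Core using (Rel)
open import Relation.Binary.Construct.Closure.ReflexiveTransitive using (Star)
open import Relation.Binary.PropositionalEquality using (_≡_; _≢_)
open import Relation.Nullary using (¬_)
open import Relation.Unary using (Pred; _∈_; U; ∅; ∁; _∩_; _∪_)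

-- The finite set Var of variable names is Fin numVars.
record Signature : Set₁ where
  field
    D       : Set
    numVars : ℕ
    Act     : Set
    PN      : Set

  Var : Set
  Var = Fin numVars

module Expressions (𝒮 : Signature) where
  open Signature 𝒮

  data TL : Set where
    act    : Act → TL
    assign : Var → D → TL

  -- Subsets of Act, given by characteristic functions. Under excluded middle
  -- these are all the subsets; unlike Pred Act 0ℓ, they keep Proc in Set.
  ActSet : Set
  ActSet = Act → Bool

  -- Membership of a transition label in B ⊆ Act ⊆ TL; assignments are never
  -- members.
  data _∈ᴬ_ : TL → ActSet → Set where
    act : ∀ {a B} → T (B a) → act a ∈ᴬ B

  infixr 8 _·_
  infixr 7 [_≐_]⇒_
  infixl 6 _∥_
  infixl 5 _⊕_

  data Proc : Set where
    _·_     : TL → Proc → Proc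
    δ       : Proc
    _⊕_     : Proc → Proc → Proc
    _∥_     : Proc → Proc → Proc
    ∂       : ActSet → Proc → Proc
    name    : PN → Proc
    [_≐_]⇒_ : Var → D → Proc → Proc

  -- Every occurrence of X in the expression is in the scope of a prefix.
  data Guarded (X : PN) : Proc → Set where
    prefix : ∀ κ P → Guarded X (κ · P)
    δ      : Guarded X δ
    _⊕_    : ∀ {P Q} → Guarded X P → Guarded X Q → Guarded X (P ⊕ Q)
    _∥_    : ∀ {P Q} → Guarded X P → Guarded X Q → Guarded X (P ∥ Q)
    ∂      : ∀ {B P} → Guarded X P → Guarded X (∂ B P)
    name   : ∀ {Y} → X ≢ Y → Guarded X (name Y)
    cond   : ∀ {v d P} → Guarded X P → Guarded X ([ v ≐ d ]⇒ P)

  -- Functions Var → D, tabulated so that _≡_ on them is pointwise equality.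
  Valuation : Set
  Valuation = Vec D numVars

  State : Set
  State = Proc × Valuation

record ProcessAlgebra : Set₁ where
  field
    signature : Signature

  open Signature signature public
  open Expressions signature public

  field
    def     : PN → Proc
    guarded : ∀ X → Guarded X (def X)

    -- γ a b ≡ nothing means that γ(a,b) is undefined.
    γ           : Act → Act → Maybe Act
    γ-comm      : ∀ a b → γ a b ≡ γ b a
    γ-assoc     : ∀ a b c → (γ a b >>= λ e → γ e c) ≡ (γ b c >>= λ e → γ a e)
    γ-handshake : ∀ {a b c} → γ a b ≡ just c → ∀ d → γ c d ≡ nothing

module Semantics (𝒜 : ProcessAlgebra) where
  open ProcessAlgebra 𝒜 public

  infix 4 _—[_]→_

  data _—[_]→_ : State → TL → State → Set where
    act-prefix : ∀ {a P V} → (act a · P , V) —[ act a ]→ (P , V)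

    assign-prefix : ∀ {v d P V} →
      (assign v d · P , V) —[ assign v d ]→ (P , V [ v ]≔ d)

    cond : ∀ {v d κ P V P′ V′} →
      lookup V v ≡ d →
      (P , V) —[ κ ]→ (P′ , V′) →
      ([ v ≐ d ]⇒ P , V) —[ κ ]→ (P′ , V′)

    rec : ∀ {X κ V P′ V′} →
      (def X , V) —[ κ ]→ (P′ , V′) →
      (name X , V) —[ κ ]→ (P′ , V′)

    choiceˡ : ∀ {κ P Q V P′ V′} →
      (P , V) —[ κ ]→ (P′ , V′) →
      (P ⊕ Q , V) —[ κ ]→ (P′ , V′)

    choiceʳ : ∀ {κ P Q V P′ V′} →
      (P , V) —[ κ ]→ (P′ , V′) →
      (Q ⊕ P , V) —[ κ ]→ (P′ , V′)

    parˡ : ∀ {κ P Q V P′ V′} →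
      (P , V) —[ κ ]→ (P′ , V′) →
      (P ∥ Q , V) —[ κ ]→ (P′ ∥ Q , V′)

    parʳ : ∀ {κ P Q V P′ V′} →
      (P , V) —[ κ ]→ (P′ , V′) →
      (Q ∥ P , V) —[ κ ]→ (Q ∥ P′ , V′)

    encap : ∀ {κ B P V P′ V′} →
      ¬ (κ ∈ᴬ B) →
      (P , V) —[ κ ]→ (P′ , V′) →
      (∂ B P , V) —[ κ ]→ (∂ B P′ , V′)

    comm : ∀ {a b c P Q V P′ Q′} →
      (P , V) —[ act a ]→ (P′ , V) →
      (Q , V) —[ act b ]→ (Q′ , V) →
      γ a b ≡ just c →
      (P ∥ Q , V) —[ act c ]→ (P′ ∥ Q′ , V)

  IsStateBasedBisimulation : Rel State 0ℓ → Set
  IsStateBasedBisimulation R =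
    ∀ {P V₁ Q V₂} → R (P , V₁) (Q , V₂) →
      V₁ ≡ V₂
      × (∀ κ →
          (∀ {P′ V′} → (P , V₁) —[ κ ]→ (P′ , V′) →
             ∃[ Q′ ] (Q , V₂) —[ κ ]→ (Q′ , V′) × R (P′ , V′) (Q′ , V′))
          × (∀ {Q′ V′} → (Q , V₂) —[ κ ]→ (Q′ , V′) →
             ∃[ P′ ] (P , V₁) —[ κ ]→ (P′ , V′) × R (P′ , V′) (Q′ , V′)))

  StateBasedBisimilar : State → State → Set₁
  StateBasedBisimilar s t = ∃[ R ] IsStateBasedBisimulation R × R s t

  Reachable : Rel State 0ℓ
  Reachable = Star (λ s s′ → ∃[ κ ] s —[ κ ]→ s′)

  ImageFinite : State → Set
  ImageFinite s = ∀ κ → ∃[ ss ] (∀ s′ → s —[ κ ]→ s′ ⇔ s′ ∈ˡ ss)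

  -- A nonempty finite set of labels is given by a nonempty list of its
  -- elements; only list membership enters the interpretation.
  data Formula : Set where
    true false : Formula
    _≐_        : Var → D → Formula
    ¬′_        : Formula → Formula
    _∧_ _∨_    : Formula → Formula → Formula
    ⟨_⟩_ [_]_  : List⁺ TL → Formula → Formula

  ⟦_⟧ : Formula → Pred State 0ℓ
  ⟦ true ⟧      = U
  ⟦ false ⟧     = ∅
  ⟦ v ≐ e ⟧     = λ (_ , V) → lookup V v ≡ e
  ⟦ ¬′ φ ⟧      = ∁ ⟦ φ ⟧
  ⟦ φ ∧ ψ ⟧     = ⟦ φ ⟧ ∩ ⟦ ψ ⟧
  ⟦ φ ∨ ψ ⟧     = ⟦ φ ⟧ ∪ ⟦ ψ ⟧
  ⟦ ⟨ Ls ⟩ φ ⟧  = λ u →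
    ∃[ u′ ] u′ ∈ ⟦ φ ⟧ × (∃[ κ ] κ ∈ˡ toList Ls × u —[ κ ]→ u′)
  ⟦ [ Ls ] φ ⟧  = λ u →
    ∀ u′ κ → κ ∈ˡ toList Ls → u —[ κ ]→ u′ → u′ ∈ ⟦ φ ⟧

{-# OPTIONS --safe #-}
-- Bisimilar states satisfy the same formulas by induction on formulas.
-- Conversely, logical equivalence restricted to states from which only
-- image-finite states are reachable is itself a bisimulation: the checks
-- (v = e) force equal valuations, and if a κ-successor s′ of s had no equivalent
-- among the finitely many κ-successors of t, the conjunction ψ of formulas that
-- hold at s′ and fail at one of them each would make ⟨κ⟩ψ separate s from t.
module Submission where

open import Defs
open import Level using (0ℓ)
open import Axiom.ExcludedMiddle using (ExcludedMiddle)
open import Axiom.DoubleNegationElimination using (em⇒dne)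
open import Data.List using ([]; _∷_)
open import Data.List.Membership.Propositional using () renaming (_∈_ to _∈ˡ_)
open import Data.List.NonEmpty using (_∷_)
open import Data.List.Relation.Unary.All as All using (All; []; _∷_)
open import Data.List.Relation.Unary.Any using (here; there)
open import Data.Product using (_×_; _,_; proj₁; proj₂; ∃-syntax)
open import Data.Sum using (_⊎_; inj₁; inj₂)
import Data.Sum as Sum
open import Data.Vec using (Vec; lookup)
open import Data.Vec.Properties using (tabulate∘lookup; tabulate-cong)
open import Function using (_∘_; id)
open import Function.Bundles using (_⇔_; mk⇔; Equivalence)
open import Relation.Binary.Core using (Rel)
open import Relation.Binary.Construct.Closure.ReflexiveTransitive using (ε; _◅_)
open import Relation.Binary.PropositionalEquality
  using (_≡_; refl; sym; trans)
open import Relation.Nullary using (yes; no; contradiction)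
open import Relation.Unary using (_∈_; _∉_)

open Equivalence using (to; from)

lookup-ext : ∀ {A : Set} {n} (xs ys : Vec A n) →
  (∀ i → lookup xs i ≡ lookup ys i) → xs ≡ ys
lookup-ext xs ys eq =
  trans (sym (tabulate∘lookup xs)) (trans (tabulate-cong eq) (tabulate∘lookup ys))

module _ (𝒜 : ProcessAlgebra) where
  open Semantics 𝒜

  infix 4 _≈ᴸ_

  _≈ᴸ_ : Rel State 0ℓ
  s ≈ᴸ t = ∀ φ → s ∈ ⟦ φ ⟧ ⇔ t ∈ ⟦ φ ⟧

  ≈ᴸ-sym : ∀ {s t} → s ≈ᴸ t → t ≈ᴸ s
  ≈ᴸ-sym s≈t φ = mk⇔ (from (s≈t φ)) (to (s≈t φ))

  -- The induction on formulas carries both implications at once, because negation reverses them: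
  -- each direction for `¬′ φ` rests on the opposite direction for `φ`.
  bisimulation⇒≈ᴸ : ∀ {R} → IsStateBasedBisimulation R →
    ∀ {s t} → R s t → s ≈ᴸ t
  bisimulation⇒≈ᴸ {R} bisim = preserve
    where
    preserve : ∀ {s t} → R s t → s ≈ᴸ t
    preserve r true    = mk⇔ id id
    preserve r false   = mk⇔ id id
    preserve r (v ≐ e) with refl ← proj₁ (bisim r) = mk⇔ id id
    preserve r (¬′ φ)  = mk⇔ (_∘ from (preserve r φ)) (_∘ to (preserve r φ))
    preserve r (φ ∧ ψ) = mk⇔
      (λ (p , q) → to (preserve r φ) p , to (preserve r ψ) q)
      (λ (p , q) → from (preserve r φ) p , from (preserve r ψ) q)
    preserve r (φ ∨ ψ) = mk⇔
      (Sum.map (to (preserve r φ)) (to (preserve r ψ)))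
      (Sum.map (from (preserve r φ)) (from (preserve r ψ)))
    preserve r (⟨ Ls ⟩ φ) = mk⇔
      (λ (_ , p , κ , κ∈Ls , s→s′) →
        let (_ , t→t′ , r′) = proj₁ (proj₂ (bisim r) κ) s→s′
        in _ , to (preserve r′ φ) p , κ , κ∈Ls , t→t′)
      (λ (_ , p , κ , κ∈Ls , t→t′) →
        let (_ , s→s′ , r′) = proj₂ (proj₂ (bisim r) κ) t→t′
        in _ , from (preserve r′ φ) p , κ , κ∈Ls , s→s′)
    -- Dually to the diamond, a move of the target state is first pulled back to the source state,
    -- where the box hypothesis applies.
    preserve r ([ Ls ] φ) = mk⇔
      (λ p _ κ κ∈Ls t→t′ →
        let (_ , s→s′ , r′) = proj₂ (proj₂ (bisim r) κ) t→t′
        in to (preserve r′ φ) (p _ κ κ∈Ls s→s′))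
      (λ p _ κ κ∈Ls s→s′ →
        let (_ , t→t′ , r′) = proj₁ (proj₂ (bisim r) κ) s→s′
        in from (preserve r′ φ) (p _ κ κ∈Ls t→t′))

  ≈ᴸ⇒≡-valuation : ∀ {P V₁ Q V₂} → (P , V₁) ≈ᴸ (Q , V₂) → V₁ ≡ V₂
  ≈ᴸ⇒≡-valuation {V₁ = V₁} {V₂ = V₂} s≈t =
    lookup-ext V₁ V₂ λ v → sym (to (s≈t (v ≐ lookup V₁ v)) refl)

  HereditarilyImageFinite : State → Set
  HereditarilyImageFinite s = ∀ s′ → Reachable s s′ → ImageFinite s′

  HereditarilyImageFinite-step : ∀ {s κ s′} → s —[ κ ]→ s′ →
    HereditarilyImageFinite s → HereditarilyImageFinite s′
  HereditarilyImageFinite-step s→s′ fin u s′→*u = fin u ((_ , s→s′) ◅ s′→*u)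

  module _ (em : ExcludedMiddle 0ℓ) where

    -- Separation in one direction suffices: a formula that holds only at `t` is turned by `¬′_`
    -- into one that holds only at `s`.
    ≈ᴸ-or-separated : ∀ s t → s ≈ᴸ t ⊎ (∃[ φ ] s ∈ ⟦ φ ⟧ × t ∉ ⟦ φ ⟧)
    ≈ᴸ-or-separated s t with em {∃[ φ ] s ∈ ⟦ φ ⟧ × t ∉ ⟦ φ ⟧}
    ... | yes separated = inj₂ separated
    ... | no inseparable = inj₁ λ φ → mk⇔
      (λ s∈φ → em⇒dne em λ t∉φ → inseparable (φ , s∈φ , t∉φ))
      (λ t∈φ → em⇒dne em λ s∉φ → inseparable (¬′ φ , s∉φ , λ t∉φ → t∉φ t∈φ))

    ≈ᴸ-member-or-separated : ∀ s ts →
      (∃[ t ] t ∈ˡ ts × s ≈ᴸ t) ⊎ (∃[ φ ] s ∈ ⟦ φ ⟧ × All (_∉ ⟦ φ ⟧) ts)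
    -- The empty conjunction; it covers a state without κ-successors.
    ≈ᴸ-member-or-separated s [] = inj₂ (true , _ , [])
    ≈ᴸ-member-or-separated s (t ∷ ts)
      with ≈ᴸ-or-separated s t | ≈ᴸ-member-or-separated s ts
    ... | inj₁ s≈t | _ = inj₁ (t , here refl , s≈t)
    ... | inj₂ _ | inj₁ (u , u∈ts , s≈u) = inj₁ (u , there u∈ts , s≈u)
    ... | inj₂ (φ , s∈φ , t∉φ) | inj₂ (ψ , s∈ψ , ts∉ψ) =
      inj₂ (φ ∧ ψ , (s∈φ , s∈ψ) , t∉φ ∘ proj₁ ∷ All.map (_∘ proj₂) ts∉ψ)

    ≈ᴸ-simulates : ∀ {s t κ s′} → ImageFinite t → s ≈ᴸ t → s —[ κ ]→ s′ →
      ∃[ t′ ] t —[ κ ]→ t′ × s′ ≈ᴸ t′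
    ≈ᴸ-simulates {κ = κ} {s′} fin s≈t s→s′
      with ts , successor ← fin κ
      with ≈ᴸ-member-or-separated s′ ts
    ... | inj₁ (t′ , t′∈ts , s′≈t′) = t′ , from (successor t′) t′∈ts , s′≈t′
    ... | inj₂ (ψ , s′∈ψ , ts∉ψ)
      with to (s≈t (⟨ κ ∷ [] ⟩ ψ)) (s′ , s′∈ψ , κ , here refl , s→s′)
    -- The label set is a singleton, so the label of the move of `t` is `κ` and `t′` occurs in `ts`.
    ... | t′ , t′∈ψ , _ , here refl , t→t′ =
      contradiction t′∈ψ (All.lookup ts∉ψ (to (successor t′) t→t′))

    -- Finiteness is part of the relation so that it passes to successors; it is kept on both sides
    -- because the forth clause uses it at `t` and the back clause at `s`.
    _≈ᶠ_ : Rel State 0ℓ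
    s ≈ᶠ t = HereditarilyImageFinite s × HereditarilyImageFinite t × s ≈ᴸ t

    ≈ᶠ-sym : ∀ {s t} → s ≈ᶠ t → t ≈ᶠ s
    ≈ᶠ-sym (finˢ , finᵗ , s≈t) = finᵗ , finˢ , ≈ᴸ-sym s≈t

    ≈ᶠ-simulates : ∀ {s t κ P′ V′} → s ≈ᶠ t → s —[ κ ]→ (P′ , V′) →
      ∃[ Q′ ] t —[ κ ]→ (Q′ , V′) × (P′ , V′) ≈ᶠ (Q′ , V′)
    ≈ᶠ-simulates {t = t} (finˢ , finᵗ , s≈t) s→s′
      with (Q′ , _) , t→t′ , s′≈t′ ← ≈ᴸ-simulates (finᵗ t ε) s≈t s→s′
      -- The matching move must end in the same valuation `V′`; logical equivalence of the two
      -- successors ensures this.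
      with refl ← ≈ᴸ⇒≡-valuation s′≈t′ =
      Q′ , t→t′ , HereditarilyImageFinite-step s→s′ finˢ
                , HereditarilyImageFinite-step t→t′ finᵗ , s′≈t′

    ≈ᶠ-isBisimulation : IsStateBasedBisimulation _≈ᶠ_
    ≈ᶠ-isBisimulation s≈t@(_ , _ , s≈ᴸt) = ≈ᴸ⇒≡-valuation s≈ᴸt , λ _ →
      ≈ᶠ-simulates s≈t ,
      λ t→t′ → let (P′ , s→s′ , t′≈s′) = ≈ᶠ-simulates (≈ᶠ-sym s≈t) t→t′
               in P′ , s→s′ , ≈ᶠ-sym t′≈s′

theorem12 : ExcludedMiddle 0ℓ →
    (𝒜 : ProcessAlgebra) → let open Semantics 𝒜 in
    (P Q : Proc) (V : Valuation) →
    (∀ s → Reachable (P , V) s → ImageFinite s) →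
    (∀ s → Reachable (Q , V) s → ImageFinite s) →
    StateBasedBisimilar (P , V) (Q , V) ⇔ (∀ φ → (P , V) ∈ ⟦ φ ⟧ ⇔ (Q , V) ∈ ⟦ φ ⟧)
theorem12 em 𝒜 P Q V finP finQ = mk⇔
  (λ (_ , bisim , r) → bisimulation⇒≈ᴸ 𝒜 bisim r)
  (λ s≈t → _≈ᶠ_ 𝒜 em , (λ {_ _ _ _} → ≈ᶠ-isBisimulation 𝒜 em) , finP , finQ , s≈t)
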